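{- Let $G$ be a simple, undirected, connected graph on $N$ vertices with degree sequence $d_1\le d_2\le\cdots\le d_N$, and let $H=\sum_{1\le i<j\le N}\frac{d_j}{d_i}$. Then $$R^+(G)\ge N(N-3)+H+\left[\frac{N(N-1)}{2}\right]^2\frac{1}{H}.$$
   Context: For vertices $i,j$ of $G$, $R_{ij}$ denotes the effective resistance between $i$ and $j$ when every edge of $G$ is a unit resistor. The additive degree-Kirchhoff index is $R^+(G)=\sum_{i<j}(d_i+d_j)R_{ij}$, where $d_i$ is the degree of vertex $i$. -}

module Defs where

open import Data.Bool.Base using (true; false; if_then_else_)
open import Data.Fin.Base as Fin using (Fin; zero; suc)
open import Data.Fin.Permutation using (Permutation′; _⟨$⟩ʳ_)
import Data.Fin.Properties as Fin
open import Data.Fin.Subset using (Subset; ∣_∣; ⁅_⁆; _∈_)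
import Data.Fin.Subset.Properties as Subset
open import Data.Integer.Base using (+_)
open import Data.Nat.Base as ℕ using (ℕ; suc; s≤s; z≤n)
import Data.Nat.Properties as ℕ
open import Data.Product.Base using (_×_; _,_; ∃-syntax)
open import Data.Rational.Base hiding (∣_∣)
open import Data.Rational.Properties
open import Data.Vec.Base using (tabulate)
open import Data.Vec.Properties using (lookup⇒[]=; lookup∘tabulate)
open import Level using (0ℓ)
open import Relation.Binary.Construct.Closure.ReflexiveTransitive using (Star; ε; _◅_)
open import Relation.Binary.Core using (Rel)
open import Relation.Binary.Definitions using (Decidable; Symmetric; Irreflexive)
open import Relation.Binary.PropositionalEquality
  using (_≡_; _≢_; refl; sym; trans; subst)
open import Relation.Nullary using (contradiction)
open import Relation.Nullary.Decidable using (does; dec-true)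

open import Algebra.Properties.CommutativeMonoid.Sum +-0-commutativeMonoid public
  using (sum; sum-syntax)

private
  variable
    n : ℕ

fromℕ : ℕ → ℚ
fromℕ k = + k / 1

∑-pairs : (Fin n → Fin n → ℚ) → ℚ
∑-pairs {n} f = ∑[ i < n ] ∑[ j < n ] (if does (i Fin.<? j) then f i j else 0ℚ)

record SimpleGraph (n : ℕ) : Set₁ where
  field
    _~_      : Rel (Fin n) 0ℓ
    _~?_     : Decidable _~_
    ~-sym    : Symmetric _~_
    ~-irrefl : Irreflexive _≡_ _~_

  neighbours : Fin n → Subset n
  neighbours i = tabulate (λ j → does (i ~? j))

  degree : Fin n → ℕ
  degree i = ∣ neighbours i ∣

  Connected : Set
  Connected = ∀ i j → Star _~_ i j

open SimpleGraph public using (degree; Connected)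

-- The degrees in nondecreasing order; the vertices themselves may be
-- numbered in any order.
record IsDegreeSequence (G : SimpleGraph n) (d : Fin n → ℕ) : Set where
  field
    sorted    : ∀ {i j} → i Fin.≤ j → d i ℕ.≤ d j
    labelling : Permutation′ n
    degrees   : ∀ i → d i ≡ degree G (labelling ⟨$⟩ʳ i)

-- By Ohm's law, the current along an edge k ~ l of unit resistance is v k - v l.
netCurrent : SimpleGraph n → (Fin n → ℚ) → Fin n → ℚ
netCurrent {n} G v k = ∑[ l < n ] (if does (k ~? l) then v k - v l else 0ℚ)
  where open SimpleGraph G

δ : Fin n → Fin n → ℚ
δ i k = if does (i Fin.≟ k) then 1ℚ else 0ℚ

-- r is the voltage between i and j when a unit current enters at i and leaves
-- at j (Kirchhoff's current law at every vertex).  In a connected graph there is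
-- exactly one such r, and it is rational because the linear system for the
-- potential v has integer coefficients.
IsEffectiveResistance : SimpleGraph n → Fin n → Fin n → ℚ → Set
IsEffectiveResistance {n} G i j r =
  ∃[ v ] (∀ k → netCurrent G v k ≡ δ i k - δ j k) × r ≡ v i - v j

R⁺ : SimpleGraph n → (Fin n → Fin n → ℚ) → ℚ
R⁺ G R = ∑-pairs λ i j → fromℕ (degree G i ℕ.+ degree G j) * R i j

H : (d : Fin n → ℕ) → (∀ i → ℕ.NonZero (d i)) → ℚ
H d d≢0 = ∑-pairs λ i j → (+ d j / d i) {{d≢0 i}}

module _ (G : SimpleGraph n) where
  open SimpleGraph G using (_~_; _~?_; neighbours)

  private
    ~⇒degree≢0 : ∀ {i j} → i ~ j → ℕ.NonZero (degree G i)
    ~⇒degree≢0 {i} {j} i~j = ℕ.>-nonZero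
      (subst (ℕ._≤ degree G i) (Subset.∣⁅x⁆∣≡1 j) (Subset.p⊆q⇒∣p∣≤∣q∣ ⁅j⁆⊆N))
      where
      j∈N : j ∈ neighbours i
      j∈N = lookup⇒[]= j (neighbours i)
        (trans (lookup∘tabulate _ j) (dec-true (i ~? j) i~j))

      ⁅j⁆⊆N : ∀ {k} → k ∈ ⁅ j ⁆ → k ∈ neighbours i
      ⁅j⁆⊆N k∈ = subst (_∈ neighbours i) (sym (Subset.x∈⁅y⁆⇒x≡y j k∈)) j∈N

    another : 2 ℕ.≤ n → (i : Fin n) → ∃[ j ] i ≢ j
    another (s≤s (s≤s _)) zero    = suc zero , λ ()
    another (s≤s (s≤s _)) (suc i) = zero , λ ()

  degree≢0 : 2 ℕ.≤ n → Connected G → ∀ i → ℕ.NonZero (degree G i)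
  degree≢0 2≤n conn i with another 2≤n i
  ... | j , i≢j with conn i j
  ...   | ε       = contradiction refl i≢j
  ...   | i~k ◅ _ = ~⇒degree≢0 i~k

  degreeSequence≢0 : 2 ℕ.≤ n → Connected G →
    ∀ {d} → IsDegreeSequence G d → ∀ i → ℕ.NonZero (d i)
  degreeSequence≢0 2≤n conn ds i =
    subst ℕ.NonZero (sym (degrees i)) (degree≢0 2≤n conn (labelling ⟨$⟩ʳ i))
    where open IsDegreeSequence ds

private
  sum-nonNeg : (f : Fin n → ℚ) → (∀ i → 0ℚ ≤ f i) → 0ℚ ≤ sum f
  sum-nonNeg {ℕ.zero} f f≥0 = ≤-refl
  sum-nonNeg {suc n}  f f≥0 =
    +-mono-≤ (f≥0 zero) (sum-nonNeg (λ i → f (suc i)) (λ i → f≥0 (suc i)))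

  sum-pos : (f : Fin n → ℚ) → (∀ i → 0ℚ ≤ f i) → ∀ i → 0ℚ < f i → 0ℚ < sum f
  sum-pos f f≥0 zero    fi>0 =
    +-mono-<-≤ fi>0 (sum-nonNeg (λ i → f (suc i)) (λ i → f≥0 (suc i)))
  sum-pos f f≥0 (suc i) fi>0 =
    +-mono-≤-< (f≥0 zero) (sum-pos (λ i → f (suc i)) (λ i → f≥0 (suc i)) i fi>0)

  if-nonNeg : ∀ b {p} → 0ℚ ≤ p → 0ℚ ≤ (if b then p else 0ℚ)
  if-nonNeg true  p≥0 = p≥0
  if-nonNeg false p≥0 = ≤-refl

  ratio-pos : ∀ p q → ℕ.NonZero p → (q≢0 : ℕ.NonZero q) → 0ℚ < (+ p / q) {{q≢0}}
  ratio-pos (suc p) q _ q≢0 = positive⁻¹ _ {{normalize-pos (suc p) q {{q≢0}}}}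

H-pos : 2 ℕ.≤ n → (d : Fin n → ℕ) (d≢0 : ∀ i → ℕ.NonZero (d i)) → 0ℚ < H d d≢0
H-pos {n} (s≤s (s≤s _)) d d≢0 =
  sum-pos _ (λ i → sum-nonNeg (term i) (term≥0 i)) zero
    (sum-pos (term zero) (term≥0 zero) (suc zero)
      (ratio-pos (d (suc zero)) (d zero) (d≢0 (suc zero)) (d≢0 zero)))
  where
  term : Fin n → Fin n → ℚ
  term i j = if does (i Fin.<? j) then (+ d j / d i) {{d≢0 i}} else 0ℚ

  term≥0 : ∀ i j → 0ℚ ≤ term i j
  term≥0 i j = if-nonNeg (does (i Fin.<? j))
    (<⇒≤ (ratio-pos (d j) (d i) (d≢0 j) (d≢0 i)))

H≢0 : 2 ℕ.≤ n → (d : Fin n → ℕ) (d≢0 : ∀ i → ℕ.NonZero (d i)) → NonZero (H d d≢0)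
H≢0 2≤n d d≢0 = pos⇒nonZero (H d d≢0) {{positive (H-pos 2≤n d d≢0)}}

{-# OPTIONS --safe #-}
-- Fix i ≠ j.  Positivity of the Dirichlet form at f − v, where v is the potential
-- of the unit current from i to j, gives 2 (f i − f j) ≤ R i j + dirichlet f f for
-- every f (Thomson's principle).  The test function f = δ i / dᵢ − δ j / dⱼ
-- yields R i j ≥ 1/dᵢ + 1/dⱼ − 2 aᵢⱼ / (dᵢ dⱼ), with a the adjacency matrix.
-- Multiplied by dᵢ + dⱼ and summed over pairs, the main terms give
-- N (N − 1) + H + H′, where H′ sums the reciprocals of the terms of H, and the
-- corrections give 2 ∑_{i<j} aᵢⱼ (1/dᵢ + 1/dⱼ) = 2 N.  Finally H H′ is at least
-- the square of the number of pairs by Cauchy–Schwarz.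
module Submission where

open import Defs
import Algebra.Properties.Semiring.Sum as SemiringSum
open import Algebra.Bundles using (CommutativeRing)
open import Data.Bool.Base using (Bool; true; false; if_then_else_)
open import Data.Fin.Base as Fin using (Fin; zero; suc)
open import Data.Fin.Permutation using (Permutation′; _⟨$⟩ʳ_)
import Data.Fin.Properties as Fin
open import Data.Fin.Subset using (∣_∣)
open import Data.Integer.Base as ℤ using (+_)
import Data.Integer.Properties as ℤ
open import Data.Nat.Base as ℕ using (ℕ)
import Data.Nat.Properties as ℕ
open import Data.Product.Base using (_,_)
open import Data.Rational.Base
  using (ℚ; _+_; _-_; _*_; -_; ½; 1/_; _≥_; _≤_; 0ℚ; 1ℚ; _/_; toℚᵘ; nonNegative; *≤*)
open import Data.Rational.Properties
import Data.Rational.Unnormalised.Base as ℚᵘ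
import Data.Rational.Unnormalised.Properties as ℚᵘ
open import Data.Sum.Base using (inj₁; inj₂)
open import Data.Vec.Base using (tabulate)
open import Function.Bundles using (mk⇔)
open import Level using (0ℓ)
open import Relation.Binary.Definitions using (tri<; tri≈; tri>)
open import Relation.Binary.PropositionalEquality
  using (_≡_; _≢_; refl; sym; trans; cong; cong₂; subst₂; module ≡-Reasoning)
open import Relation.Nullary using (Dec; yes; no; ¬_)
open import Relation.Nullary.Decidable using (does; dec⇒maybe; dec-true; dec-false; does-⇔)
open import Tactic.RingSolver using (solve-∀)
import Tactic.RingSolver.Core.AlmostCommutativeRing as ACR
open import Algebra.Properties.Group +-0-group using (∙-cancelʳ)

private
  variable
    n : ℕ

ℚ-ring : ACR.AlmostCommutativeRing 0ℓ 0ℓ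
ℚ-ring = ACR.fromCommutativeRing +-*-commutativeRing (λ q → dec⇒maybe (0ℚ ≟ q))

private
  module M = SemiringSum (CommutativeRing.semiring +-*-commutativeRing)

-- Inequalities and embeddings into ℚ

0≤p*q : ∀ {p q} → 0ℚ ≤ p → 0ℚ ≤ q → 0ℚ ≤ p * q
0≤p*q {p} {q} p≥0 q≥0 = nonNegative⁻¹ _
  {{nonNeg*nonNeg⇒nonNeg p {{nonNegative p≥0}} q {{nonNegative q≥0}}}}

0≤p² : ∀ p → 0ℚ ≤ p * p
0≤p² p with ≤-total 0ℚ p
... | inj₁ p≥0 = 0≤p*q p≥0 p≥0
... | inj₂ p≤0 = ≤-trans (0≤p*q (neg-antimono-≤ p≤0) (neg-antimono-≤ p≤0)) (≤-reflexive (lemma p))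
  where
  lemma : ∀ p → - p * - p ≡ p * p
  lemma = solve-∀ ℚ-ring

p≤p+q : ∀ p {q} → 0ℚ ≤ q → p ≤ p + q
p≤p+q p q≥0 = ≤-trans (≤-reflexive (sym (+-identityʳ p))) (+-monoʳ-≤ p q≥0)

p≤q+s⇒p-s≤q : ∀ {p q} s → p ≤ q + s → p - s ≤ q
p≤q+s⇒p-s≤q {p} {q} s p≤q+s = ≤-trans (+-monoˡ-≤ (- s) p≤q+s) (≤-reflexive (lemma q s))
  where
  lemma : ∀ q s → q + s - s ≡ q
  lemma = solve-∀ ℚ-ring

½[p+p]≡p : ∀ p → ½ * (p + p) ≡ p
½[p+p]≡p p = begin
  ½ * (p + p)     ≡⟨ lemma ½ p ⟩
  -- Both summands are closed rationals, so `½ + ½` evaluates to `1ℚ`; the ring identity before it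
  -- is proved for an arbitrary factor in place of `½`.
  (½ + ½) * p     ≡⟨⟩
  1ℚ * p          ≡⟨ *-identityˡ p ⟩
  p               ∎
  where
  open ≡-Reasoning
  lemma : ∀ x p → x * (p + p) ≡ (x + x) * p
  lemma = solve-∀ ℚ-ring

halve-≤ : ∀ {p q} → p + p ≤ q + q → p ≤ q
halve-≤ {p} {q} p+p≤q+q =
  subst₂ _≤_ (½[p+p]≡p p) (½[p+p]≡p q) (*-monoˡ-≤-nonNeg ½ p+p≤q+q)

-- `_/_` divides by a gcd and does not reduce on open arguments. In `ℚᵘ` a fraction stays a pair, so
-- the identities below become cross-multiplications of integers.
toℚᵘ-/ : ∀ a b-1 → toℚᵘ (+ a / ℕ.suc b-1) ℚᵘ.≃ ℚᵘ.mkℚᵘ (+ a) b-1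
toℚᵘ-/ a b-1 = toℚᵘ-fromℚᵘ (ℚᵘ.mkℚᵘ (+ a) b-1)

fromℕ-+ : ∀ a b → fromℕ (a ℕ.+ b) ≡ fromℕ a + fromℕ b
fromℕ-+ a b = toℚᵘ-injective (begin
  toℚᵘ (fromℕ (a ℕ.+ b))                 ≈⟨ toℚᵘ-/ (a ℕ.+ b) 0 ⟩
  ℚᵘ.mkℚᵘ (+ (a ℕ.+ b)) 0                ≈⟨ ℚᵘ.*≡* (cong (ℤ._* + 1)
                                              (cong₂ ℤ._+_ (ℤ.*-identityʳ (+ a)) (ℤ.*-identityʳ (+ b)))) ⟨
  ℚᵘ.mkℚᵘ (+ a) 0 ℚᵘ.+ ℚᵘ.mkℚᵘ (+ b) 0   ≈⟨ ℚᵘ.+-cong (toℚᵘ-/ a 0) (toℚᵘ-/ b 0) ⟨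
  toℚᵘ (fromℕ a) ℚᵘ.+ toℚᵘ (fromℕ b)     ≈⟨ toℚᵘ-homo-+ (fromℕ a) (fromℕ b) ⟨
  toℚᵘ (fromℕ a + fromℕ b)               ∎)
  where open ℚᵘ.≃-Reasoning

/-*-fromℕ : ∀ a b (b≢0 : ℕ.NonZero b) → (+ a / b) {{b≢0}} * fromℕ b ≡ fromℕ a
/-*-fromℕ a b@(ℕ.suc b-1) _ = toℚᵘ-injective (begin
  toℚᵘ (+ a / b * fromℕ b)               ≈⟨ toℚᵘ-homo-* (+ a / b) (fromℕ b) ⟩
  toℚᵘ (+ a / b) ℚᵘ.* toℚᵘ (fromℕ b)     ≈⟨ ℚᵘ.*-cong (toℚᵘ-/ a b-1) (toℚᵘ-/ b 0) ⟩
  ℚᵘ.mkℚᵘ (+ a) b-1 ℚᵘ.* ℚᵘ.mkℚᵘ (+ b) 0 ≈⟨ ℚᵘ.*≡* (trans (ℤ.*-identityʳ (+ a ℤ.* + b))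
                                              (cong (λ m → + a ℤ.* + m) (sym (ℕ.*-identityʳ b)))) ⟩
  ℚᵘ.mkℚᵘ (+ a) 0                        ≈⟨ toℚᵘ-/ a 0 ⟨
  toℚᵘ (fromℕ a)                         ∎)
  where open ℚᵘ.≃-Reasoning

0≤/ : ∀ a b (b≢0 : ℕ.NonZero b) → 0ℚ ≤ (+ a / b) {{b≢0}}
0≤/ a b b≢0 = nonNegative⁻¹ _ {{normalize-nonNeg a b {{b≢0}}}}

recip : (m : ℕ) → ℕ.NonZero m → ℚ
recip m m≢0 = (+ 1 / m) {{m≢0}}

-- Brings the ratios in `H` to the form of a weight times a degree, on which the ring solver can
-- work. Multiplying by `recip b b≢0 * fromℕ b`, which is 1, gives it.
/≡recip* : ∀ a b (b≢0 : ℕ.NonZero b) → (+ a / b) {{b≢0}} ≡ recip b b≢0 * fromℕ a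
/≡recip* a b b≢0 = begin
  x                                   ≡⟨ *-identityʳ x ⟨
  x * 1ℚ                              ≡⟨ cong (x *_) (/-*-fromℕ 1 b b≢0) ⟨
  x * (recip b b≢0 * fromℕ b)         ≡⟨ lemma x (recip b b≢0) (fromℕ b) ⟩
  recip b b≢0 * (x * fromℕ b)         ≡⟨ cong (recip b b≢0 *_) (/-*-fromℕ a b b≢0) ⟩
  recip b b≢0 * fromℕ a               ∎
  where
  open ≡-Reasoning
  x = (+ a / b) {{b≢0}}
  lemma : ∀ x y z → x * (y * z) ≡ y * (x * z)
  lemma = solve-∀ ℚ-ring

𝟙 : Bool → ℚ
𝟙 b = if b then 1ℚ else 0ℚ

-- As a factor, the condition can be moved through sums by distributivity and handled by the ring
-- solver.
if≡𝟙* : ∀ b p → (if b then p else 0ℚ) ≡ 𝟙 b * p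
if≡𝟙* true  p = sym (*-identityˡ p)
if≡𝟙* false p = sym (*-zeroˡ p)

-- The inequality is asked for only where the decision is positive. In this way `i < j`, and with it
-- `i ≢ j`, becomes available for the bound on a single resistance.
if-mono-≤ : ∀ {P : Set} {p q} (P? : Dec P) → (P → p ≤ q) →
  (if does P? then p else 0ℚ) ≤ (if does P? then q else 0ℚ)
if-mono-≤ (yes x) p≤q = p≤q x
if-mono-≤ (no _)  p≤q = ≤-refl

0≤𝟙 : ∀ b → 0ℚ ≤ 𝟙 b
0≤𝟙 true  = *≤* (ℤ.+≤+ ℕ.z≤n)
0≤𝟙 false = ≤-refl

-- Finite sums

sum-mono-≤ : {f g : Fin n → ℚ} → (∀ i → f i ≤ g i) → sum f ≤ sum g
sum-mono-≤ {ℕ.zero}  f≤g = ≤-refl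
sum-mono-≤ {ℕ.suc n} f≤g = +-mono-≤ (f≤g zero) (sum-mono-≤ (λ i → f≤g (suc i)))

sum-const : ∀ n q → ∑[ i < n ] q ≡ fromℕ n * q
sum-const ℕ.zero    q = sym (*-zeroˡ q)
sum-const (ℕ.suc n) q = begin
  q + ∑[ i < n ] q           ≡⟨ cong (λ x → q + x) (sum-const n q) ⟩
  q + fromℕ n * q            ≡⟨ lemma q (fromℕ n) ⟩
  (1ℚ + fromℕ n) * q         ≡⟨ cong (_* q) (fromℕ-+ 1 n) ⟨
  fromℕ (ℕ.suc n) * q        ∎
  where
  open ≡-Reasoning
  lemma : ∀ q m → q + m * q ≡ (1ℚ + m) * q
  lemma = solve-∀ ℚ-ring

sum-𝟙 : (b : Fin n → Bool) → fromℕ ∣ tabulate b ∣ ≡ ∑[ i < n ] 𝟙 (b i)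
sum-𝟙 {ℕ.zero}  b = refl
sum-𝟙 {ℕ.suc n} b with b zero
... | true  = trans
  (fromℕ-+ 1 ∣ tabulate (λ i → b (suc i)) ∣)
  (cong (λ x → 1ℚ + x) (sum-𝟙 (λ i → b (suc i))))
... | false = trans (sum-𝟙 (λ i → b (suc i))) (sym (+-identityˡ _))

∑∑-cong : {f g : Fin n → Fin n → ℚ} → (∀ i j → f i j ≡ g i j) →
  ∑[ i < n ] ∑[ j < n ] f i j ≡ ∑[ i < n ] ∑[ j < n ] g i j
∑∑-cong f≡g = M.sum-cong-≗ λ i → M.sum-cong-≗ (f≡g i)

∑∑-mono-≤ : {f g : Fin n → Fin n → ℚ} → (∀ i j → f i j ≤ g i j) →
  ∑[ i < n ] ∑[ j < n ] f i j ≤ ∑[ i < n ] ∑[ j < n ] g i j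
∑∑-mono-≤ f≤g = sum-mono-≤ λ i → sum-mono-≤ (f≤g i)

∑∑-distrib-+ : (f g : Fin n → Fin n → ℚ) →
  ∑[ i < n ] ∑[ j < n ] (f i j + g i j) ≡
  ∑[ i < n ] ∑[ j < n ] f i j + ∑[ i < n ] ∑[ j < n ] g i j
∑∑-distrib-+ {n} f g = trans
  (M.sum-cong-≗ λ i → M.∑-distrib-+ (f i) (g i))
  (M.∑-distrib-+ (λ i → sum (f i)) (λ i → sum (g i)))

*-distribˡ-∑∑ : ∀ q (f : Fin n → Fin n → ℚ) →
  q * ∑[ i < n ] ∑[ j < n ] f i j ≡ ∑[ i < n ] ∑[ j < n ] (q * f i j)
*-distribˡ-∑∑ q f = trans (M.*-distribˡ-sum q (λ i → sum (f i)))
  (M.sum-cong-≗ λ i → M.*-distribˡ-sum q (f i))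

sum-δ : ∀ i (f : Fin n → ℚ) → ∑[ k < n ] (δ i k * f k) ≡ f i
sum-δ {ℕ.suc n} zero f = begin
  1ℚ * f zero + ∑[ k < n ] (0ℚ * f (suc k))  ≡⟨ cong₂ _+_ (*-identityˡ (f zero))
                                                  (M.sum-cong-≗ λ k → *-zeroˡ (f (suc k))) ⟩
  f zero + ∑[ k < n ] 0ℚ                     ≡⟨ cong (λ x → f zero + x) (M.sum-replicate-zero n) ⟩
  f zero + 0ℚ                                ≡⟨ +-identityʳ (f zero) ⟩
  f zero                                     ∎
  where open ≡-Reasoning
sum-δ {ℕ.suc n} (suc i) f = begin
  0ℚ * f zero + ∑[ k < n ] (δ i k * f (suc k))  ≡⟨ cong₂ _+_ (*-zeroˡ (f zero)) (sum-δ i (λ k → f (suc k))) ⟩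
  0ℚ + f (suc i)                                ≡⟨ +-identityˡ (f (suc i)) ⟩
  f (suc i)                                     ∎
  where open ≡-Reasoning

δ-refl : (i : Fin n) → δ i i ≡ 1ℚ
δ-refl i = cong 𝟙 (dec-true (i Fin.≟ i) refl)

δ-≢ : {i j : Fin n} → i ≢ j → δ i j ≡ 0ℚ
δ-≢ {i = i} {j} i≢j = cong 𝟙 (dec-false (i Fin.≟ j) i≢j)

-- Sums over pairs

∑-pairs≡∑∑ : (f : Fin n → Fin n → ℚ) →
  ∑-pairs f ≡ ∑[ i < n ] ∑[ j < n ] (𝟙 (does (i Fin.<? j)) * f i j)
∑-pairs≡∑∑ f = ∑∑-cong λ i j → if≡𝟙* (does (i Fin.<? j)) (f i j)

∑-pairs-mono-≤ : (f g : Fin n → Fin n → ℚ) → (∀ {i j} → i Fin.< j → f i j ≤ g i j) →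
  ∑-pairs f ≤ ∑-pairs g
∑-pairs-mono-≤ f g f≤g = ∑∑-mono-≤ λ i j → if-mono-≤ (i Fin.<? j) f≤g

∑-pairs-cong : {f g : Fin n → Fin n → ℚ} → (∀ i j → f i j ≡ g i j) → ∑-pairs f ≡ ∑-pairs g
∑-pairs-cong f≡g = ∑∑-cong λ i j → cong (λ x → if does (i Fin.<? j) then x else 0ℚ) (f≡g i j)

∑-pairs-distrib-+ : (f g : Fin n → Fin n → ℚ) →
  ∑-pairs (λ i j → f i j + g i j) ≡ ∑-pairs f + ∑-pairs g
∑-pairs-distrib-+ {n} f g = begin
  ∑-pairs (λ i j → f i j + g i j)
    ≡⟨ ∑-pairs≡∑∑ (λ i j → f i j + g i j) ⟩
  ∑[ i < n ] ∑[ j < n ] (χ i j * (f i j + g i j))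
    ≡⟨ ∑∑-cong (λ i j → *-distribˡ-+ (χ i j) (f i j) (g i j)) ⟩
  ∑[ i < n ] ∑[ j < n ] (χ i j * f i j + χ i j * g i j)
    ≡⟨ ∑∑-distrib-+ (λ i j → χ i j * f i j) (λ i j → χ i j * g i j) ⟩
  ∑[ i < n ] ∑[ j < n ] (χ i j * f i j) + ∑[ i < n ] ∑[ j < n ] (χ i j * g i j)
    ≡⟨ cong₂ _+_ (∑-pairs≡∑∑ f) (∑-pairs≡∑∑ g) ⟨
  ∑-pairs f + ∑-pairs g
    ∎
  where
  open ≡-Reasoning
  χ : Fin n → Fin n → ℚ
  χ i j = 𝟙 (does (i Fin.<? j))

*-distribˡ-∑-pairs : ∀ q (f : Fin n → Fin n → ℚ) → q * ∑-pairs f ≡ ∑-pairs (λ i j → q * f i j)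
*-distribˡ-∑-pairs {n} q f = begin
  q * ∑-pairs f                                     ≡⟨ cong (q *_) (∑-pairs≡∑∑ f) ⟩
  q * ∑[ i < n ] ∑[ j < n ] (χ i j * f i j)         ≡⟨ *-distribˡ-∑∑ q (λ i j → χ i j * f i j) ⟩
  ∑[ i < n ] ∑[ j < n ] (q * (χ i j * f i j))       ≡⟨ ∑∑-cong (λ i j → lemma q (χ i j) (f i j)) ⟩
  ∑[ i < n ] ∑[ j < n ] (χ i j * (q * f i j))       ≡⟨ ∑-pairs≡∑∑ (λ i j → q * f i j) ⟨
  ∑-pairs (λ i j → q * f i j)                       ∎
  where
  open ≡-Reasoning
  χ : Fin n → Fin n → ℚ
  χ i j = 𝟙 (does (i Fin.<? j))
  lemma : ∀ x y z → x * (y * z) ≡ y * (x * z)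
  lemma = solve-∀ ℚ-ring

-- The full square splits into its upper triangle, its lower triangle and its diagonal, by
-- trichotomy of the order on `Fin n`.
∑-pairs-symmetrise : (f : Fin n → Fin n → ℚ) →
  ∑-pairs f + ∑-pairs (λ i j → f j i) + ∑[ i < n ] f i i ≡ ∑[ i < n ] ∑[ j < n ] f i j
∑-pairs-symmetrise {n} f = begin
  ∑-pairs f + ∑-pairs (λ i j → f j i) + ∑[ i < n ] f i i
    ≡⟨ cong₂ (λ x y → ∑-pairs f + x + y)
         -- Exchanging the order of summation makes the second sum run over `j < i` with the summand
         -- `f i j`; the diagonal is spread over the square by `δ`.
         (M.∑-comm (λ j i → upper j i (f i j)))
         (M.sum-cong-≗ λ i → sym (sum-δ i (f i))) ⟩
  ∑[ i < n ] ∑[ j < n ] upper i j (f i j) + ∑[ i < n ] ∑[ j < n ] upper j i (f i j)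
    + ∑[ i < n ] ∑[ j < n ] (δ i j * f i j)
    ≡⟨ cong (λ x → x + ∑[ i < n ] ∑[ j < n ] (δ i j * f i j))
         (∑∑-distrib-+ (λ i j → upper i j (f i j)) (λ i j → upper j i (f i j))) ⟨
  ∑[ i < n ] ∑[ j < n ] (upper i j (f i j) + upper j i (f i j))
    + ∑[ i < n ] ∑[ j < n ] (δ i j * f i j)
    ≡⟨ ∑∑-distrib-+ (λ i j → upper i j (f i j) + upper j i (f i j)) (λ i j → δ i j * f i j) ⟨
  ∑[ i < n ] ∑[ j < n ] (upper i j (f i j) + upper j i (f i j) + δ i j * f i j)
    ≡⟨ ∑∑-cong (λ i j → trichotomy i j (f i j)) ⟩
  ∑[ i < n ] ∑[ j < n ] f i j
    ∎
  where
  open ≡-Reasoning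
  upper : Fin n → Fin n → ℚ → ℚ
  upper i j x = if does (i Fin.<? j) then x else 0ℚ

  upper-< : ∀ {i j} x → i Fin.< j → upper i j x ≡ x
  upper-< {i} {j} x i<j = cong (λ b → if b then x else 0ℚ) (dec-true (i Fin.<? j) i<j)

  upper-≮ : ∀ {i j} x → ¬ i Fin.< j → upper i j x ≡ 0ℚ
  upper-≮ {i} {j} x i≮j = cong (λ b → if b then x else 0ℚ) (dec-false (i Fin.<? j) i≮j)

  lemma₁ : ∀ x → x + 0ℚ + 0ℚ * x ≡ x
  lemma₁ = solve-∀ ℚ-ring
  lemma₂ : ∀ x → 0ℚ + 0ℚ + 1ℚ * x ≡ x
  lemma₂ = solve-∀ ℚ-ring
  lemma₃ : ∀ x → 0ℚ + x + 0ℚ * x ≡ x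
  lemma₃ = solve-∀ ℚ-ring

  add₃ : ∀ {x x′ y y′ z z′ : ℚ} w → x ≡ x′ → y ≡ y′ → z ≡ z′ → x + y + z * w ≡ x′ + y′ + z′ * w
  add₃ w refl refl refl = refl

  trichotomy : ∀ i j x → upper i j x + upper j i x + δ i j * x ≡ x
  trichotomy i j x with Fin.<-cmp i j
  ... | tri< i<j i≢j j≮i = trans (add₃ x (upper-< x i<j) (upper-≮ x j≮i) (δ-≢ i≢j)) (lemma₁ x)
  ... | tri≈ i≮j refl j≮i = trans (add₃ x (upper-≮ x i≮j) (upper-≮ x j≮i) (δ-refl i)) (lemma₂ x)
  ... | tri> i≮j i≢j j<i = trans (add₃ x (upper-≮ x i≮j) (upper-< x j<i) (δ-≢ i≢j)) (lemma₃ x)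

-- The Dirichlet form and Thomson's principle

-- Serves three times: for the unit current of Kirchhoff's law (`x` and `y` both 1), for the test
-- function, and for the rows of the adjacency matrix.
sum-dipole : ∀ i j x y (g : Fin n → ℚ) →
  ∑[ k < n ] ((x * δ i k - y * δ j k) * g k) ≡ x * g i - y * g j
sum-dipole {n} i j x y g = begin
  ∑[ k < n ] ((x * δ i k - y * δ j k) * g k)
    ≡⟨ M.sum-cong-≗ (λ k → lemma x y (δ i k) (δ j k) (g k)) ⟩
  ∑[ k < n ] (x * (δ i k * g k) + - y * (δ j k * g k))
    ≡⟨ M.∑-distrib-+ (λ k → x * (δ i k * g k)) (λ k → - y * (δ j k * g k)) ⟩
  ∑[ k < n ] (x * (δ i k * g k)) + ∑[ k < n ] (- y * (δ j k * g k))
    ≡⟨ cong₂ _+_ (M.*-distribˡ-sum x (λ k → δ i k * g k)) (M.*-distribˡ-sum (- y) (λ k → δ j k * g k)) ⟨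
  x * ∑[ k < n ] (δ i k * g k) + - y * ∑[ k < n ] (δ j k * g k)
    ≡⟨ cong₂ (λ s t → x * s + - y * t) (sum-δ i g) (sum-δ j g) ⟩
  x * g i + - y * g j
    ≡⟨ cong (λ t → x * g i + t) (neg-distribˡ-* y (g j)) ⟨
  x * g i - y * g j
    ∎
  where
  open ≡-Reasoning
  lemma : ∀ x y d e g → (x * d - y * e) * g ≡ x * (d * g) + - y * (e * g)
  lemma = solve-∀ ℚ-ring

module _ (G : SimpleGraph n) where
  open SimpleGraph G using (_~?_; ~-sym; ~-irrefl)

  adjacency : Fin n → Fin n → ℚ
  adjacency k l = 𝟙 (does (k ~? l))

  private
    a : Fin n → Fin n → ℚ
    a = adjacency

    deg : Fin n → ℚ
    deg k = fromℕ (degree G k)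

  adjacency-sym : ∀ k l → adjacency k l ≡ adjacency l k
  adjacency-sym k l = cong 𝟙 (does-⇔ (mk⇔ ~-sym ~-sym) (k ~? l) (l ~? k))

  adjacency-irrefl : ∀ k → adjacency k k ≡ 0ℚ
  adjacency-irrefl k = cong 𝟙 (dec-false (k ~? k) (~-irrefl refl))

  degree≡∑adjacency : ∀ k → fromℕ (degree G k) ≡ ∑[ l < n ] adjacency k l
  degree≡∑adjacency k = sum-𝟙 (λ l → does (k ~? l))

  netCurrent≡∑ : ∀ v k → netCurrent G v k ≡ ∑[ l < n ] (adjacency k l * (v k - v l))
  netCurrent≡∑ v k = M.sum-cong-≗ λ l → if≡𝟙* (does (k ~? l)) (v k - v l)

  -- `netCurrent G g` is the graph Laplacian applied to `g`, so this is the bilinear energy form of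
  -- the network.
  dirichlet : (f g : Fin n → ℚ) → ℚ
  dirichlet f g = ∑[ k < n ] (f k * netCurrent G g k)

  -- Discrete Green's formula. In the second copy `k` and `l` are exchanged and the symmetry of the
  -- adjacency matrix is applied. The doubling on the left reflects that the right side meets every
  -- edge in both directions.
  green : ∀ f g → dirichlet f g + dirichlet f g ≡
    ∑[ k < n ] ∑[ l < n ] (adjacency k l * ((f k - f l) * (g k - g l)))
  green f g = begin
    dirichlet f g + dirichlet f g
      ≡⟨ cong₂ _+_ expand (trans expand (M.∑-comm t)) ⟩
    ∑[ k < n ] ∑[ l < n ] t k l + ∑[ k < n ] ∑[ l < n ] t l k
      ≡⟨ ∑∑-distrib-+ t (λ k l → t l k) ⟨
    ∑[ k < n ] ∑[ l < n ] (t k l + t l k)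
      ≡⟨ ∑∑-cong (λ k l → trans
           (cong (λ x → t k l + f l * (x * (g l - g k))) (adjacency-sym l k))
           (lemma (a k l) (f k) (f l) (g k) (g l))) ⟩
    ∑[ k < n ] ∑[ l < n ] (a k l * ((f k - f l) * (g k - g l)))
      ∎
    where
    open ≡-Reasoning
    t : Fin n → Fin n → ℚ
    t k l = f k * (a k l * (g k - g l))

    expand : dirichlet f g ≡ ∑[ k < n ] ∑[ l < n ] t k l
    expand = M.sum-cong-≗ λ k → trans
      (cong (f k *_) (netCurrent≡∑ g k))
      (M.*-distribˡ-sum (f k) (λ l → a k l * (g k - g l)))

    lemma : ∀ a f f′ g g′ →
      f * (a * (g - g′)) + f′ * (a * (g′ - g)) ≡ a * ((f - f′) * (g - g′))
    lemma = solve-∀ ℚ-ring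

  -- By `green` all three forms are sums over edges, where `2xy ≤ x² + y²` holds term by term
  -- because the weights are nonnegative; `halve-≤` then removes the doubling.
  dirichlet-AM-GM : ∀ f g →
    dirichlet f g + dirichlet f g ≤ dirichlet f f + dirichlet g g
  dirichlet-AM-GM f g = halve-≤ (begin
    (dirichlet f g + dirichlet f g) + (dirichlet f g + dirichlet f g)
      ≡⟨ cong₂ _+_ (green f g) (green f g) ⟩
    ∑[ k < n ] ∑[ l < n ] t f g k l + ∑[ k < n ] ∑[ l < n ] t f g k l
      ≡⟨ ∑∑-distrib-+ (t f g) (t f g) ⟨
    ∑[ k < n ] ∑[ l < n ] (t f g k l + t f g k l)
      ≤⟨ ∑∑-mono-≤ (λ k l → pointwise (a k l) (0≤𝟙 (does (k ~? l))) (f k - f l) (g k - g l)) ⟩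
    ∑[ k < n ] ∑[ l < n ] (t f f k l + t g g k l)
      ≡⟨ ∑∑-distrib-+ (t f f) (t g g) ⟩
    ∑[ k < n ] ∑[ l < n ] t f f k l + ∑[ k < n ] ∑[ l < n ] t g g k l
      ≡⟨ cong₂ _+_ (green f f) (green g g) ⟨
    (dirichlet f f + dirichlet f f) + (dirichlet g g + dirichlet g g)
      ≡⟨ lemma₂ (dirichlet f f) (dirichlet g g) ⟩
    (dirichlet f f + dirichlet g g) + (dirichlet f f + dirichlet g g)
      ∎)
    where
    open ≤-Reasoning
    t : (f g : Fin n → ℚ) → Fin n → Fin n → ℚ
    t f g k l = a k l * ((f k - f l) * (g k - g l))

    lemma₁ : ∀ c x y → c * (x * y) + c * (x * y) + c * ((x - y) * (x - y)) ≡ c * (x * x) + c * (y * y)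
    lemma₁ = solve-∀ ℚ-ring

    lemma₂ : ∀ x y → (x + x) + (y + y) ≡ (x + y) + (x + y)
    lemma₂ = solve-∀ ℚ-ring

    pointwise : ∀ c → 0ℚ ≤ c → ∀ x y → c * (x * y) + c * (x * y) ≤ c * (x * x) + c * (y * y)
    pointwise c c≥0 x y = ≤-trans
      (p≤p+q _ (0≤p*q c≥0 (0≤p² (x - y))))
      (≤-reflexive (lemma₁ c x y))

  -- The Laplacian of the potential `v` is `δ i - δ j`, so pairing any `g` with `v` gives
  -- `g i - g j`. For `g = f` this is the left side, and for `g = v` it is the resistance.
  thomson : ∀ {i j r} → IsEffectiveResistance G i j r → ∀ f →
    (f i - f j) + (f i - f j) ≤ r + dirichlet f f
  thomson {i} {j} {r} (v , kirchhoff , r≡) f = begin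
    (f i - f j) + (f i - f j)      ≡⟨ cong₂ _+_ (drop f) (drop f) ⟨
    dirichlet f v + dirichlet f v  ≤⟨ dirichlet-AM-GM f v ⟩
    dirichlet f f + dirichlet v v  ≡⟨ cong (λ x → dirichlet f f + x) (trans (drop v) (sym r≡)) ⟩
    dirichlet f f + r              ≡⟨ +-comm (dirichlet f f) r ⟩
    r + dirichlet f f              ∎
    where
    open ≤-Reasoning
    lemma : ∀ x d e → x * (d - e) ≡ (1ℚ * d - 1ℚ * e) * x
    lemma = solve-∀ ℚ-ring

    drop : ∀ g → dirichlet g v ≡ g i - g j
    drop g = trans
      (M.sum-cong-≗ λ k → trans (cong (g k *_) (kirchhoff k)) (lemma (g k) (δ i k) (δ j k)))
      (trans (sum-dipole i j 1ℚ 1ℚ g) (cong₂ _-_ (*-identityˡ (g i)) (*-identityˡ (g j))))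

  -- Dipole test functions and the bound on a single resistance

  netCurrent-dipole : ∀ i j x y k → netCurrent G (λ l → x * δ i l - y * δ j l) k ≡
    (x * δ i k - y * δ j k) * deg k - (x * adjacency k i - y * adjacency k j)
  netCurrent-dipole i j x y k = begin
    netCurrent G f k
      ≡⟨ netCurrent≡∑ f k ⟩
    ∑[ l < n ] (a k l * (f k - f l))
      ≡⟨ M.sum-cong-≗ (λ l → lemma₁ (a k l) (f k) (f l)) ⟩
    ∑[ l < n ] (f k * a k l + - 1ℚ * (f l * a k l))
      ≡⟨ M.∑-distrib-+ (λ l → f k * a k l) (λ l → - 1ℚ * (f l * a k l)) ⟩
    ∑[ l < n ] (f k * a k l) + ∑[ l < n ] (- 1ℚ * (f l * a k l))
      ≡⟨ cong₂ _+_ (M.*-distribˡ-sum (f k) (a k)) (M.*-distribˡ-sum (- 1ℚ) (λ l → f l * a k l)) ⟨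
    f k * ∑[ l < n ] a k l + - 1ℚ * ∑[ l < n ] (f l * a k l)
      -- The Laplacian as degree matrix minus adjacency matrix: the row sum of `a k` is the degree,
      -- and the dipole selects the two entries of that row at `i` and `j`.
      ≡⟨ cong₂ (λ s t → f k * s + - 1ℚ * t) (sym (degree≡∑adjacency k)) (sum-dipole i j x y (a k)) ⟩
    f k * deg k + - 1ℚ * (x * a k i - y * a k j)
      ≡⟨ lemma₂ (f k * deg k) (x * a k i - y * a k j) ⟩
    f k * deg k - (x * a k i - y * a k j)
      ∎
    where
    open ≡-Reasoning
    f : Fin n → ℚ
    f l = x * δ i l - y * δ j l
    lemma₁ : ∀ c p q → c * (p - q) ≡ p * c + - 1ℚ * (q * c)
    lemma₁ = solve-∀ ℚ-ring
    lemma₂ : ∀ p q → p + - 1ℚ * q ≡ p - q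
    lemma₂ = solve-∀ ℚ-ring

  -- Only the Laplacian entries at `i` and `j` enter: the degrees on the diagonal and minus the
  -- adjacency off it. The two poles have opposite signs, so the cross terms come out with a plus.
  dirichlet-dipole : ∀ {i j} → i ≢ j → ∀ x y →
    let f = λ k → x * δ i k - y * δ j k in
    dirichlet f f ≡ x * x * deg i + y * y * deg j + (x * y * adjacency i j + x * y * adjacency i j)
  dirichlet-dipole {i} {j} i≢j x y = begin
    dirichlet f f
      ≡⟨ sum-dipole i j x y (netCurrent G f) ⟩
    x * netCurrent G f i - y * netCurrent G f j
      ≡⟨ cong₂ (λ s t → x * s - y * t) (netCurrent-dipole i j x y i) (netCurrent-dipole i j x y j) ⟩
    x * ((x * δ i i - y * δ j i) * deg i - (x * a i i - y * a i j)) -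
    y * ((x * δ i j - y * δ j j) * deg j - (x * a j i - y * a j j))
      ≡⟨ cong₂ (λ s t → x * s - y * t)
           (entries (δ-refl i) (δ-≢ (λ j≡i → i≢j (sym j≡i))) (adjacency-irrefl i) refl)
           (entries (δ-≢ i≢j) (δ-refl j) (adjacency-sym j i) (adjacency-irrefl j)) ⟩
    x * ((x * 1ℚ - y * 0ℚ) * deg i - (x * 0ℚ - y * a i j)) -
    y * ((x * 0ℚ - y * 1ℚ) * deg j - (x * a i j - y * 0ℚ))
      ≡⟨ lemma x y (deg i) (deg j) (a i j) ⟩
    x * x * deg i + y * y * deg j + (x * y * a i j + x * y * a i j)
      ∎
    where
    open ≡-Reasoning
    f : Fin n → ℚ
    f l = x * δ i l - y * δ j l

    entries : ∀ {p p′ q q′ s s′ t t′ d : ℚ} → p ≡ p′ → q ≡ q′ → s ≡ s′ → t ≡ t′ →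
      (x * p - y * q) * d - (x * s - y * t) ≡ (x * p′ - y * q′) * d - (x * s′ - y * t′)
    entries refl refl refl refl = refl

    lemma : ∀ x y d e c →
      x * ((x * 1ℚ - y * 0ℚ) * d - (x * 0ℚ - y * c)) - y * ((x * 0ℚ - y * 1ℚ) * e - (x * c - y * 0ℚ)) ≡
      x * x * d + y * y * e + (x * y * c + x * y * c)
    lemma = solve-∀ ℚ-ring

  -- For the reciprocal degrees `x` and `y` the dipole has potential difference `x + y` and energy
  -- `x + y + 2 x y a`. Thomson's principle bounds twice the former by `r` plus the latter, and one
  -- `x + y` cancels.
  resistance-bound : ∀ {i j r} → i ≢ j → IsEffectiveResistance G i j r →
    ∀ x y → x * deg i ≡ 1ℚ → y * deg j ≡ 1ℚ →
    x + y ≤ r + (x * y * adjacency i j + x * y * adjacency i j)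
  resistance-bound {i} {j} {r} i≢j eff x y xd≡1 ye≡1 = begin
    x + y
      -- `x + y` is written as `2 (x + y) - (x + y)`, with explicit units and zeros standing where
      -- values of `δ` and products `x * deg i` are substituted next.
      ≡⟨ lemma₁ x y ⟩
    (f₁ - f₂) + (f₁ - f₂) - (x * 1ℚ + y * 1ℚ)
      ≡⟨ cong₂ (λ s t → (s - t) + (s - t) - (x * 1ℚ + y * 1ℚ)) fi≡ fj≡ ⟨
    (f i - f j) + (f i - f j) - (x * 1ℚ + y * 1ℚ)
      ≤⟨ +-monoˡ-≤ (- (x * 1ℚ + y * 1ℚ)) (thomson eff f) ⟩
    r + dirichlet f f - (x * 1ℚ + y * 1ℚ)
      ≡⟨ cong (λ s → r + s - (x * 1ℚ + y * 1ℚ)) (dirichlet-dipole i≢j x y) ⟩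
    r + (x * x * deg i + y * y * deg j + (c + c)) - (x * 1ℚ + y * 1ℚ)
      -- The units in the subtracted term become `x * deg i` and `y * deg j`, so that it cancels the
      -- diagonal part of the energy by ring algebra alone.
      ≡⟨ cong₂ (λ s t → r + (x * x * deg i + y * y * deg j + (c + c)) - (x * s + y * t)) xd≡1 ye≡1 ⟨
    r + (x * x * deg i + y * y * deg j + (c + c)) - (x * (x * deg i) + y * (y * deg j))
      ≡⟨ lemma₂ r x y (deg i) (deg j) c ⟩
    r + (c + c)
      ∎
    where
    open ≤-Reasoning
    f : Fin n → ℚ
    f k = x * δ i k - y * δ j k
    c f₁ f₂ : ℚ
    c = x * y * a i j
    f₁ = x * 1ℚ - y * 0ℚ
    f₂ = x * 0ℚ - y * 1ℚ

    fi≡ : f i ≡ f₁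
    fi≡ = cong₂ (λ s t → x * s - y * t) (δ-refl i) (δ-≢ (λ j≡i → i≢j (sym j≡i)))

    fj≡ : f j ≡ f₂
    fj≡ = cong₂ (λ s t → x * s - y * t) (δ-≢ i≢j) (δ-refl j)

    lemma₁ : ∀ x y → x + y ≡
      ((x * 1ℚ - y * 0ℚ) - (x * 0ℚ - y * 1ℚ)) + ((x * 1ℚ - y * 0ℚ) - (x * 0ℚ - y * 1ℚ)) - (x * 1ℚ + y * 1ℚ)
    lemma₁ = solve-∀ ℚ-ring

    lemma₂ : ∀ r x y d e c →
      r + (x * x * d + y * y * e + (c + c)) - (x * (x * d) + y * (y * e)) ≡ r + (c + c)
    lemma₂ = solve-∀ ℚ-ring

  -- Summing the resistance bound over pairs

  R⁺-bound : (R : Fin n → Fin n → ℚ) → (∀ i j → IsEffectiveResistance G i j (R i j)) →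
    (w : Fin n → ℚ) → (∀ i → w i * fromℕ (degree G i) ≡ 1ℚ) →
    ∑-pairs (λ i j → w i * fromℕ (degree G j)) + ∑-pairs (λ i j → w j * fromℕ (degree G i))
      + ∑-pairs {n} (λ _ _ → 1ℚ + 1ℚ) ≤ R⁺ G R + (fromℕ n + fromℕ n)
  R⁺-bound R eff w wd≡1 = begin
    ∑-pairs q + ∑-pairs (λ i j → q j i) + ∑-pairs {n} (λ _ _ → 1ℚ + 1ℚ)
      ≡⟨ cong (λ x → x + ∑-pairs {n} (λ _ _ → 1ℚ + 1ℚ)) (∑-pairs-distrib-+ q (λ i j → q j i)) ⟨
    ∑-pairs (λ i j → q i j + q j i) + ∑-pairs {n} (λ _ _ → 1ℚ + 1ℚ)
      ≡⟨ ∑-pairs-distrib-+ (λ i j → q i j + q j i) (λ _ _ → 1ℚ + 1ℚ) ⟨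
    ∑-pairs (λ i j → q i j + q j i + (1ℚ + 1ℚ))
      ≤⟨ ∑-pairs-mono-≤ _ _ (λ i<j → pointwise (Fin.<⇒≢ i<j)) ⟩
    ∑-pairs (λ i j → fromℕ (degree G i ℕ.+ degree G j) * R i j + ((e i j + e j i) + (e i j + e j i)))
      ≡⟨ ∑-pairs-distrib-+ (λ i j → fromℕ (degree G i ℕ.+ degree G j) * R i j) _ ⟩
    R⁺ G R + ∑-pairs (λ i j → (e i j + e j i) + (e i j + e j i))
      ≡⟨ cong (λ x → R⁺ G R + x) (∑-pairs-distrib-+ (λ i j → e i j + e j i) (λ i j → e i j + e j i)) ⟩
    R⁺ G R + (∑-pairs (λ i j → e i j + e j i) + ∑-pairs (λ i j → e i j + e j i))
      ≡⟨ cong₂ (λ x y → R⁺ G R + (x + y)) total total ⟩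
    R⁺ G R + (fromℕ n + fromℕ n)
      ∎
    where
    open ≤-Reasoning
    q e : Fin n → Fin n → ℚ
    q i j = w i * deg j
    e i j = w i * a i j

    -- The diagonal of `a` vanishes, so the sum over pairs is the full double sum. Its row `i` is
    -- `w i` times the degree of `i`, that is 1, and there are `n` rows.
    total : ∑-pairs (λ i j → e i j + e j i) ≡ fromℕ n
    total = begin-equality
      ∑-pairs (λ i j → e i j + e j i)
        ≡⟨ ∑-pairs-distrib-+ e (λ i j → e j i) ⟩
      ∑-pairs e + ∑-pairs (λ i j → e j i)
        ≡⟨ +-identityʳ _ ⟨
      ∑-pairs e + ∑-pairs (λ i j → e j i) + 0ℚ
        ≡⟨ cong (λ x → ∑-pairs e + ∑-pairs (λ i j → e j i) + x)
             (trans (M.sum-cong-≗ λ i → trans (cong (w i *_) (adjacency-irrefl i)) (*-zeroʳ (w i)))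
                    (M.sum-replicate-zero n)) ⟨
      ∑-pairs e + ∑-pairs (λ i j → e j i) + ∑[ i < n ] e i i
        ≡⟨ ∑-pairs-symmetrise e ⟩
      ∑[ i < n ] ∑[ j < n ] e i j
        ≡⟨ M.sum-cong-≗ (λ i → trans (sym (M.*-distribˡ-sum (w i) (a i)))
             (trans (cong (w i *_) (sym (degree≡∑adjacency i))) (wd≡1 i))) ⟩
      ∑[ i < n ] 1ℚ
        ≡⟨ sum-const n 1ℚ ⟩
      fromℕ n * 1ℚ
        ≡⟨ *-identityʳ (fromℕ n) ⟩
      fromℕ n
        ∎

    lemma₁ : ∀ x y d e → x * e + y * d + (x * d + y * e) ≡ (d + e) * (x + y)
    lemma₁ = solve-∀ ℚ-ring

    lemma₂ : ∀ r x y d e c → (d + e) * (r + (x * y * c + x * y * c)) ≡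
      (d + e) * r + ((y * e * (x * c) + x * d * (y * c)) + (y * e * (x * c) + x * d * (y * c)))
    lemma₂ = solve-∀ ℚ-ring

    lemma₃ : ∀ s p q → s + ((1ℚ * p + 1ℚ * q) + (1ℚ * p + 1ℚ * q)) ≡ s + ((p + q) + (p + q))
    lemma₃ = solve-∀ ℚ-ring

    0≤deg+deg : ∀ i j → 0ℚ ≤ deg i + deg j
    0≤deg+deg i j = +-mono-≤ (0≤/ (degree G i) 1 _) (0≤/ (degree G j) 1 _)

    pointwise : ∀ {i j} → i ≢ j → q i j + q j i + (1ℚ + 1ℚ) ≤
      fromℕ (degree G i ℕ.+ degree G j) * R i j + ((e i j + e j i) + (e i j + e j i))
    pointwise {i} {j} i≢j = begin
      q i j + q j i + (1ℚ + 1ℚ)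
        -- The constant 2 becomes `w i * deg i + w j * deg j`, which completes the product of the
        -- degree sum and the weight sum.
        ≡⟨ cong₂ (λ x y → q i j + q j i + (x + y)) (wd≡1 i) (wd≡1 j) ⟨
      q i j + q j i + (w i * deg i + w j * deg j)
        ≡⟨ lemma₁ (w i) (w j) (deg i) (deg j) ⟩
      (deg i + deg j) * (w i + w j)
        ≤⟨ *-monoˡ-≤-nonNeg (deg i + deg j) {{nonNegative (0≤deg+deg i j)}}
             (resistance-bound i≢j (eff i j) (w i) (w j) (wd≡1 i) (wd≡1 j)) ⟩
      (deg i + deg j) * (R i j + (w i * w j * a i j + w i * w j * a i j))
        -- In the correction each degree is grouped with the weight of its own vertex; that product
        -- is 1, and a single weight times `a i j` remains.
        ≡⟨ lemma₂ (R i j) (w i) (w j) (deg i) (deg j) (a i j) ⟩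
      (deg i + deg j) * R i j +
      ((w j * deg j * e i j + w i * deg i * (w j * a i j)) +
       (w j * deg j * e i j + w i * deg i * (w j * a i j)))
        ≡⟨ cong₂ (λ x y → (deg i + deg j) * R i j +
             ((x * e i j + y * (w j * a i j)) + (x * e i j + y * (w j * a i j)))) (wd≡1 j) (wd≡1 i) ⟩
      (deg i + deg j) * R i j +
      ((1ℚ * e i j + 1ℚ * (w j * a i j)) + (1ℚ * e i j + 1ℚ * (w j * a i j)))
        ≡⟨ lemma₃ ((deg i + deg j) * R i j) (e i j) (w j * a i j) ⟩
      (deg i + deg j) * R i j + ((e i j + w j * a i j) + (e i j + w j * a i j))
        ≡⟨ cong₂ (λ s x → s * R i j + ((e i j + w j * x) + (e i j + w j * x)))
             (sym (fromℕ-+ (degree G i) (degree G j))) (adjacency-sym i j) ⟩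
      fromℕ (degree G i ℕ.+ degree G j) * R i j + ((e i j + e j i) + (e i j + e j i))
        ∎

-- Relabelling, counting pairs, and Cauchy–Schwarz

-- A permutation need not preserve `i < j`, so a sum over pairs alone may change. With its transpose
-- added it is the full square minus the diagonal, and both of these are invariant.
∑-pairs-relabel : (π : Permutation′ n) (f : Fin n → Fin n → ℚ) →
  ∑-pairs (λ i j → f (π ⟨$⟩ʳ i) (π ⟨$⟩ʳ j)) + ∑-pairs (λ i j → f (π ⟨$⟩ʳ j) (π ⟨$⟩ʳ i)) ≡
  ∑-pairs f + ∑-pairs (λ i j → f j i)
∑-pairs-relabel {n} π f = ∙-cancelʳ (∑[ i < n ] f i i) _ _ (begin
  ∑-pairs fπ + ∑-pairs (λ i j → fπ j i) + ∑[ i < n ] f i i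
    ≡⟨ cong (λ x → ∑-pairs fπ + ∑-pairs (λ i j → fπ j i) + x) (M.∑-permute (λ i → f i i) π) ⟩
  ∑-pairs fπ + ∑-pairs (λ i j → fπ j i) + ∑[ i < n ] fπ i i
    ≡⟨ ∑-pairs-symmetrise fπ ⟩
  ∑[ i < n ] ∑[ j < n ] fπ i j
    ≡⟨ M.sum-cong-≗ (λ i → M.∑-permute (f (π ⟨$⟩ʳ i)) π) ⟨
  ∑[ i < n ] ∑[ j < n ] f (π ⟨$⟩ʳ i) j
    ≡⟨ M.∑-permute (λ i → ∑[ j < n ] f i j) π ⟨
  ∑[ i < n ] ∑[ j < n ] f i j
    ≡⟨ ∑-pairs-symmetrise f ⟨
  ∑-pairs f + ∑-pairs (λ i j → f j i) + ∑[ i < n ] f i i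
    ∎)
  where
  open ≡-Reasoning
  fπ : Fin n → Fin n → ℚ
  fπ i j = f (π ⟨$⟩ʳ i) (π ⟨$⟩ʳ j)

-- The symmetrisation of the constant 1, which counts pairs without any division.
∑-pairs-1 : ∀ n → ∑-pairs {n} (λ _ _ → 1ℚ) + ∑-pairs {n} (λ _ _ → 1ℚ) + fromℕ n ≡ fromℕ n * fromℕ n
∑-pairs-1 n = begin
  P + P + fromℕ n              ≡⟨ cong (λ x → P + P + x) ∑1≡n ⟨
  P + P + ∑[ i < n ] 1ℚ        ≡⟨ ∑-pairs-symmetrise {n} (λ _ _ → 1ℚ) ⟩
  ∑[ i < n ] ∑[ j < n ] 1ℚ     ≡⟨ sum-const n (∑[ j < n ] 1ℚ) ⟩
  fromℕ n * ∑[ j < n ] 1ℚ      ≡⟨ cong (fromℕ n *_) ∑1≡n ⟩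
  fromℕ n * fromℕ n            ∎
  where
  open ≡-Reasoning
  P : ℚ
  P = ∑-pairs {n} (λ _ _ → 1ℚ)
  ∑1≡n : ∑[ i < n ] 1ℚ ≡ fromℕ n
  ∑1≡n = trans (sum-const n 1ℚ) (*-identityʳ (fromℕ n))

-- Cauchy–Schwarz in the tangent-line form p ≥ 2 t − t² q, which holds for
-- p = 1 / q and every t; the choice t = ∑ 1 / ∑ q is optimal.
∑-pairs-reciprocal : {p q : Fin n → Fin n → ℚ} →
  (∀ i j → 0ℚ ≤ p i j) → (∀ i j → p i j * q i j ≡ 1ℚ) →
  ∀ s → s * ∑-pairs q ≡ 1ℚ →
  ∑-pairs {n} (λ _ _ → 1ℚ) * ∑-pairs {n} (λ _ _ → 1ℚ) * s ≤ ∑-pairs p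
∑-pairs-reciprocal {n} {p} {q} p≥0 pq≡1 s sh≡1 = begin
  P * P * s
    -- At `t = P * s` the summed tangent bound `2 t P - t² ∑ q` equals `P² s`, because `s` is the
    -- inverse of `∑-pairs q`.
    ≡⟨ lemma₁ P s ⟩
  (t + t) * P - t * P * 1ℚ
    ≡⟨ cong (λ x → (t + t) * P - t * P * x) sh≡1 ⟨
  (t + t) * P - t * P * (s * ∑-pairs q)
    ≡⟨ cong₂ _-_ (*-distribˡ-∑-pairs {n} (t + t) (λ _ _ → 1ℚ)) (lemma₂ t P s (∑-pairs q)) ⟩
  ∑-pairs {n} (λ _ _ → (t + t) * 1ℚ) - t * t * ∑-pairs q
    ≤⟨ p≤q+s⇒p-s≤q (t * t * ∑-pairs q) summed ⟩
  ∑-pairs p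
    ∎
  where
  open ≤-Reasoning
  P t : ℚ
  P = ∑-pairs {n} (λ _ _ → 1ℚ)
  t = P * s

  lemma₁ : ∀ P s → P * P * s ≡ (P * s + P * s) * P - P * s * P * 1ℚ
  lemma₁ = solve-∀ ℚ-ring
  lemma₂ : ∀ t P s h → t * P * (s * h) ≡ t * (P * s) * h
  lemma₂ = solve-∀ ℚ-ring
  lemma₃ : ∀ p q t → (t + t) * (p * q) + p * ((1ℚ - t * q) * (1ℚ - t * q)) ≡
    p * 1ℚ + t * t * (p * q) * q + (t + t) * (p * q - p * q)
  lemma₃ = solve-∀ ℚ-ring
  lemma₄ : ∀ p q t → p * 1ℚ + t * t * 1ℚ * q + (t + t) * (1ℚ - 1ℚ) ≡ p + t * t * q
  lemma₄ = solve-∀ ℚ-ring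

  tangent : ∀ x y → 0ℚ ≤ x → x * y ≡ 1ℚ → (t + t) * 1ℚ ≤ x + t * t * y
  tangent x y x≥0 xy≡1 = begin
    (t + t) * 1ℚ
      ≡⟨ cong ((t + t) *_) xy≡1 ⟨
    (t + t) * (x * y)
      -- The gap in the tangent inequality is `x (1 - t y)²`, which expands to `x - 2 t + t² y` once
      -- `x * y` is replaced by 1.
      ≤⟨ p≤p+q _ (0≤p*q x≥0 (0≤p² (1ℚ - t * y))) ⟩
    (t + t) * (x * y) + x * ((1ℚ - t * y) * (1ℚ - t * y))
      ≡⟨ lemma₃ x y t ⟩
    x * 1ℚ + t * t * (x * y) * y + (t + t) * (x * y - x * y)
      ≡⟨ cong (λ z → x * 1ℚ + t * t * z * y + (t + t) * (z - z)) xy≡1 ⟩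
    x * 1ℚ + t * t * 1ℚ * y + (t + t) * (1ℚ - 1ℚ)
      ≡⟨ lemma₄ x y t ⟩
    x + t * t * y
      ∎

  summed : ∑-pairs {n} (λ _ _ → (t + t) * 1ℚ) ≤ ∑-pairs p + t * t * ∑-pairs q
  summed = begin
    ∑-pairs {n} (λ _ _ → (t + t) * 1ℚ)
      ≤⟨ ∑-pairs-mono-≤ _ _ (λ {i} {j} _ → tangent (p i j) (q i j) (p≥0 i j) (pq≡1 i j)) ⟩
    ∑-pairs (λ i j → p i j + t * t * q i j)
      ≡⟨ ∑-pairs-distrib-+ p (λ i j → t * t * q i j) ⟩
    ∑-pairs p + ∑-pairs (λ i j → t * t * q i j)
      ≡⟨ cong (λ x → ∑-pairs p + x) (*-distribˡ-∑-pairs (t * t) q) ⟨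
    ∑-pairs p + t * t * ∑-pairs q
      ∎

-- Assembling the bound

theorem4 : (N : ℕ) (2≤N : 2 ℕ.≤ N) (G : SimpleGraph N) (conn : Connected G)
    (d : Fin N → ℕ) (ds : IsDegreeSequence G d)
    (R : Fin N → Fin N → ℚ) → (∀ i j → IsEffectiveResistance G i j (R i j)) →
    let d≢0 = degreeSequence≢0 G 2≤N conn ds
        h   = H d d≢0
        1/h = (1/ h) {{H≢0 2≤N d d≢0}}
        c   = fromℕ N * (fromℕ N - fromℕ 1) * ½
    in R⁺ G R ≥ fromℕ N * (fromℕ N - fromℕ 3) + h + c * c * 1/h
theorem4 N 2≤N G conn d ds R eff = begin
  m * (m - fromℕ 3) + h + c * c * 1/h
    ≤⟨ +-monoʳ-≤ (m * (m - fromℕ 3) + h) c²/h≤h′ ⟩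
  m * (m - fromℕ 3) + h + h′
    -- `m (m - 3)` is split as `(m² - m) - 2 m`: twice the number of pairs, less the total of the
    -- adjacency corrections. `fromℕ 3` evaluates to `1ℚ + 1ℚ + 1ℚ`.
    ≡⟨ lemma₁ m h h′ ⟩
  h + h′ + (m * m - m) - (m + m)
    ≡⟨ cong₂ (λ x y → x + y - (m + m)) h+h′≡ (sym 2P≡) ⟩
  ∑-pairs q + ∑-pairs (λ i j → q j i) + (P + P) - (m + m)
    ≡⟨ cong (λ x → ∑-pairs q + ∑-pairs (λ i j → q j i) + x - (m + m))
       (∑-pairs-distrib-+ {N} (λ _ _ → 1ℚ) (λ _ _ → 1ℚ)) ⟨
  ∑-pairs q + ∑-pairs (λ i j → q j i) + ∑-pairs {N} (λ _ _ → 1ℚ + 1ℚ) - (m + m)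
    ≤⟨ p≤q+s⇒p-s≤q (m + m) (R⁺-bound G R eff w wd≡1) ⟩
  R⁺ G R
    ∎
  where
  open ≤-Reasoning
  open IsDegreeSequence ds using (labelling; degrees)
  d≢0 : ∀ i → ℕ.NonZero (d i)
  d≢0 = degreeSequence≢0 G 2≤N conn ds
  h 1/h m c P : ℚ
  h = H d d≢0
  1/h = (1/ h) {{H≢0 2≤N d d≢0}}
  m = fromℕ N
  c = m * (m - fromℕ 1) * ½
  P = ∑-pairs {N} (λ _ _ → 1ℚ)

  w : Fin N → ℚ
  w i = recip (degree G i) (degree≢0 G 2≤N conn i)

  wd≡1 : ∀ i → w i * fromℕ (degree G i) ≡ 1ℚ
  wd≡1 i = /-*-fromℕ 1 (degree G i) (degree≢0 G 2≤N conn i)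

  q qπ : Fin N → Fin N → ℚ
  q i j = w i * fromℕ (degree G j)
  qπ i j = q (labelling ⟨$⟩ʳ i) (labelling ⟨$⟩ʳ j)

  -- The transposed ratios, which are the reciprocals of the terms of `h`.
  h′ : ℚ
  h′ = ∑-pairs (λ i j → qπ j i)

  ratio-cong : ∀ {a a′ b b′} (b≢0 : ℕ.NonZero b) (b′≢0 : ℕ.NonZero b′) → a ≡ a′ → b ≡ b′ →
    (+ a / b) {{b≢0}} ≡ (+ a′ / b′) {{b′≢0}}
  ratio-cong _ _ refl refl = refl

  h≡ : h ≡ ∑-pairs qπ
  h≡ = ∑-pairs-cong λ i j → trans
    (ratio-cong (d≢0 i) (degree≢0 G 2≤N conn (labelling ⟨$⟩ʳ i)) (degrees j) (degrees i))
    (/≡recip* (degree G (labelling ⟨$⟩ʳ j)) (degree G (labelling ⟨$⟩ʳ i))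
      (degree≢0 G 2≤N conn (labelling ⟨$⟩ʳ i)))

  -- `h` runs over pairs in degree order and `R⁺` over pairs of vertices of `G`; only the symmetric
  -- sum `h + h′` is carried from one numbering to the other.
  h+h′≡ : h + h′ ≡ ∑-pairs q + ∑-pairs (λ i j → q j i)
  h+h′≡ = trans (cong (λ x → x + h′) h≡) (∑-pairs-relabel labelling q)

  lemma₁ : ∀ m h h′ → m * (m - (1ℚ + 1ℚ + 1ℚ)) + h + h′ ≡ h + h′ + (m * m - m) - (m + m)
  lemma₁ = solve-∀ ℚ-ring
  lemma₂ : ∀ p m → p + m - m ≡ p
  lemma₂ = solve-∀ ℚ-ring
  lemma₃ : ∀ m x → m * (m - 1ℚ) * x ≡ x * (m * m - m)
  lemma₃ = solve-∀ ℚ-ring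
  lemma₄ : ∀ x y d e → y * d * (x * e) ≡ (x * d) * (y * e)
  lemma₄ = solve-∀ ℚ-ring

  2P≡ : P + P ≡ m * m - m
  2P≡ = trans (sym (lemma₂ (P + P) m)) (cong (λ x → x - m) (∑-pairs-1 N))

  c≡P : c ≡ P
  c≡P = trans (lemma₃ m ½) (trans (cong (½ *_) (sym 2P≡)) (½[p+p]≡p P))

  qq≡1 : ∀ i j → q j i * q i j ≡ 1ℚ
  qq≡1 i j = trans (lemma₄ (w i) (w j) (fromℕ (degree G i)) (fromℕ (degree G j)))
    (trans (cong₂ _*_ (wd≡1 i) (wd≡1 j)) (*-identityˡ 1ℚ))

  0≤q : ∀ i j → 0ℚ ≤ q i j
  0≤q i j = 0≤p*q (0≤/ 1 (degree G i) (degree≢0 G 2≤N conn i)) (0≤/ (degree G j) 1 _)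

  -- Cauchy-Schwarz with `c` as the number of pairs, applied to the terms of `h′` and their
  -- reciprocals, whose sum is `h`.
  c²/h≤h′ : c * c * 1/h ≤ h′
  c²/h≤h′ = ≤-trans (≤-reflexive (cong (λ x → x * x * 1/h) c≡P))
    (∑-pairs-reciprocal
      (λ i j → 0≤q (labelling ⟨$⟩ʳ j) (labelling ⟨$⟩ʳ i))
      (λ i j → qq≡1 (labelling ⟨$⟩ʳ i) (labelling ⟨$⟩ʳ j))
      1/h
      (trans (cong (1/h *_) (sym h≡)) (*-inverseˡ h {{H≢0 2≤N d d≢0}})))
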